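{- Let $G=(V,E)$ be a finite simple undirected graph with chromatic number $\chi(G)$, let $q(G)=\chi(G)-1$, and let $\kappa$ be a positive integer with $\kappa\ge q(G)+1$. If $(w^*,z^*)$ is an optimal solution to $AO(G,\kappa)$, then $z^*<\kappa$.
   Context: Let $m=|E|$. Let $D=(V,A)$ be the directed graph with $A=\{(i,j),(j,i)\mid [i,j]\in E\}$. Paths are directed and elementary (no repeated vertices); paths and cycles are identified with their arc sets. $P_\kappa(A)$ denotes the set of all paths in $D$ with exactly $\kappa$ arcs, and $C(A)$ the set of all directed (elementary) cycles in $D$, with $|C|$ the number of arcs of $C$. The problem $AO(G,\kappa)$, in variables $(w,z)\in\mathbb{R}^{2m}\times\mathbb{R}$ with $w=(w_{ij})_{(i,j)\in A}$, is: minimize $z$ subject to (1) $w_{ij}+w_{ji}=1$ for all $[i,j]\in E$; (2) $\sum_{(i,j)\in C}w_{ij}\le |C|-1$ for all $C\in C(A)$; (3) $\sum_{(i,j)\in p}w_{ij}\le z$ for all $p\in P_\kappa(A)$; (4) $w_{ij}\in\{0,1\}$ for all $(i,j)\in A$; (5) $0\le z\le\kappa$. An optimal solution is a feasible pair $(w,z)$, i.e. one satisfying (1)--(5), with minimum value of $z$. By a known theorem (Roy, Gallai, Deming), $q(G)=\chi(G)-1$ equals the minimum, over all acyclic orientations $\omega$ of $G$, of the number of arcs in a longest directed path of the oriented graph $G_\omega$. -}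

module Defs where

open import Level using (0ℓ)
open import Algebra.Bundles using (CommutativeMonoid)
import Algebra.Properties.CommutativeSemigroup as CommutativeSemigroupProperties
open import Data.Bool.Base using (Bool; T)
open import Data.Nat.Base as ℕ using (ℕ; suc; _⊔_)
import Data.Nat.Properties as ℕₚ
open import Data.Integer.Base using (+_)
open import Data.Rational.Base as ℚ using (ℚ; 0ℚ; 1ℚ; ½; ∣_∣)
import Data.Rational.Properties as ℚₚ
open import Data.Fin.Base using (Fin)
open import Data.List.Base using (List; []; _∷_; _∷ʳ_; map; foldr; length)
open import Data.List.Relation.Unary.Linked using (Linked; []; [-]; _∷_)
open import Data.List.Relation.Unary.Unique.Propositional using (Unique)
open import Data.Product.Base using (Σ-syntax; ∃-syntax; _×_; _,_)
open import Data.Sum.Base using (_⊎_)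
open import Relation.Binary.Core using (Rel)
open import Relation.Binary.Definitions using (Symmetric)
open import Relation.Nullary.Negation.Core using (¬_)
open import Relation.Binary.PropositionalEquality
  using (_≡_; _≢_; refl; sym; trans; cong; subst)

------------------------------------------------------------------------
-- Real numbers, as Cauchy sequences of rationals. The quotient is not
-- taken: equality of reals is the relation _≈_.

IsCauchy : (ℕ → ℚ) → Set
IsCauchy x = ∀ ε → 0ℚ ℚ.< ε →
  ∃[ N ] ∀ m n → N ℕ.≤ m → N ℕ.≤ n → ∣ x m ℚ.- x n ∣ ℚ.< ε

record ℝ : Set where
  constructor mkℝ
  field
    seq    : ℕ → ℚ
    cauchy : IsCauchy seq

open ℝ public

infix  4 _≈_ _≤_ _<_
infixl 6 _+_ _-_
infix  8 -_

_≈_ : Rel ℝ 0ℓ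
x ≈ y = ∀ ε → 0ℚ ℚ.< ε →
  ∃[ N ] ∀ n → N ℕ.≤ n → ∣ seq x n ℚ.- seq y n ∣ ℚ.< ε

_≤_ : Rel ℝ 0ℓ
x ≤ y = ∀ ε → 0ℚ ℚ.< ε →
  ∃[ N ] ∀ n → N ℕ.≤ n → seq x n ℚ.≤ seq y n ℚ.+ ε

_<_ : Rel ℝ 0ℓ
x < y = ∃[ ε ] (0ℚ ℚ.< ε ×
  ∃[ N ] ∀ n → N ℕ.≤ n → seq x n ℚ.+ ε ℚ.≤ seq y n)

fromℚ : ℚ → ℝ
fromℚ p = mkℝ (λ _ → p) λ ε 0<ε →
  0 , λ _ _ _ _ → subst (λ r → ∣ r ∣ ℚ.< ε) (sym (ℚₚ.+-inverseʳ p)) 0<ε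

fromℕ : ℕ → ℝ
fromℕ n = fromℚ (+ n ℚ./ 1)

0ℝ 1ℝ : ℝ
0ℝ = fromℕ 0
1ℝ = fromℕ 1

private
  open CommutativeSemigroupProperties
    (CommutativeMonoid.commutativeSemigroup ℚₚ.+-0-commutativeMonoid)
    using (interchange)

  sub-interchange : ∀ a b c d →
    (a ℚ.+ b) ℚ.- (c ℚ.+ d) ≡ (a ℚ.- c) ℚ.+ (b ℚ.- d)
  sub-interchange a b c d =
    trans (cong ((a ℚ.+ b) ℚ.+_) (ℚₚ.neg-distrib-+ c d))
          (interchange a b (ℚ.- c) (ℚ.- d))

  half+half : ∀ ε → ½ ℚ.* ε ℚ.+ ½ ℚ.* ε ≡ ε
  half+half ε =
    trans (sym (ℚₚ.*-distribʳ-+ ε ½ ½)) (ℚₚ.*-identityˡ ε)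

  0<half : ∀ ε → 0ℚ ℚ.< ε → 0ℚ ℚ.< ½ ℚ.* ε
  0<half ε 0<ε =
    subst (ℚ._< ½ ℚ.* ε) (ℚₚ.*-zeroʳ ½) (ℚₚ.*-monoʳ-<-pos ½ 0<ε)

_+_ : ℝ → ℝ → ℝ
x + y = mkℝ (λ n → seq x n ℚ.+ seq y n) λ ε 0<ε →
  let (M , p) = cauchy x (½ ℚ.* ε) (0<half ε 0<ε)
      (N , q) = cauchy y (½ ℚ.* ε) (0<half ε 0<ε)
  in M ⊔ N , λ m n M⊔N≤m M⊔N≤n → let open ℚₚ.≤-Reasoning in begin-strict
    ∣ (seq x m ℚ.+ seq y m) ℚ.- (seq x n ℚ.+ seq y n) ∣
      ≡⟨ cong ∣_∣ (sub-interchange (seq x m) (seq y m) (seq x n) (seq y n)) ⟩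
    ∣ (seq x m ℚ.- seq x n) ℚ.+ (seq y m ℚ.- seq y n) ∣
      ≤⟨ ℚₚ.∣p+q∣≤∣p∣+∣q∣ (seq x m ℚ.- seq x n) (seq y m ℚ.- seq y n) ⟩
    ∣ seq x m ℚ.- seq x n ∣ ℚ.+ ∣ seq y m ℚ.- seq y n ∣
      <⟨ ℚₚ.+-mono-<
           (p m n (ℕₚ.m⊔n≤o⇒m≤o M N M⊔N≤m) (ℕₚ.m⊔n≤o⇒m≤o M N M⊔N≤n))
           (q m n (ℕₚ.m⊔n≤o⇒n≤o M N M⊔N≤m) (ℕₚ.m⊔n≤o⇒n≤o M N M⊔N≤n)) ⟩
    ½ ℚ.* ε ℚ.+ ½ ℚ.* ε
      ≡⟨ half+half ε ⟩
    ε ∎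

-_ : ℝ → ℝ
- x = mkℝ (λ n → ℚ.- seq x n) λ ε 0<ε →
  let (N , p) = cauchy x ε 0<ε
  in N , λ m n N≤m N≤n → subst (ℚ._< ε)
    (sym (trans (cong ∣_∣ (sym (ℚₚ.neg-distrib-+ (seq x m) (ℚ.- seq x n))))
                (ℚₚ.∣-p∣≡∣p∣ (seq x m ℚ.- seq x n))))
    (p m n N≤m N≤n)

_-_ : ℝ → ℝ → ℝ
x - y = x + (- y)

sum : List ℝ → ℝ
sum = foldr _+_ 0ℝ

------------------------------------------------------------------------
-- Finite simple graphs

-- The adjacency is Boolean-valued so that each ordered pair of adjacent
-- vertices carries exactly one arc (T b has at most one element).
record Graph : Set where
  field
    order : ℕ
    adj   : Fin order → Fin order → Bool

  V : Set
  V = Fin order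

  _~_ : Rel V 0ℓ
  i ~ j = T (adj i j)

  field
    ~-sym    : Symmetric _~_
    ~-irrefl : ∀ {i} → ¬ (i ~ i)

module _ (G : Graph) where
  open Graph G

  Colourable : ℕ → Set
  Colourable k = Σ[ c ∈ (V → Fin k) ] (∀ {i j} → i ~ j → c i ≢ c j)

  IsChromaticNumber : ℕ → Set
  IsChromaticNumber χ = Colourable χ × (∀ k → Colourable k → χ ℕ.≤ k)

  ----------------------------------------------------------------------
  -- The symmetric digraph D = (V , A), its paths and its cycles

  Arc : Set
  Arc = Σ[ i ∈ V ] Σ[ j ∈ V ] i ~ j

  linkedArcs : ∀ {vs} → Linked _~_ vs → List Arc
  linkedArcs []      = []
  linkedArcs [-]     = []
  linkedArcs (a ∷ l) = (_ , _ , a) ∷ linkedArcs l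

  record Path : Set where
    field
      start    : V
      rest     : List V
      linked   : Linked _~_ (start ∷ rest)
      distinct : Unique (start ∷ rest)

    arcs : List Arc
    arcs = linkedArcs linked

  -- Each cycle occurs once for every choice of its start. The cycles
  -- i → j → i are included; there are no loops, as _~_ is irreflexive.
  record Cycle : Set where
    field
      start    : V
      rest     : List V
      linked   : Linked _~_ (start ∷ (rest ∷ʳ start))
      distinct : Unique (start ∷ rest)

    arcs : List Arc
    arcs = linkedArcs linked

  ----------------------------------------------------------------------
  -- The problem AO(G, κ)

  record Feasible (κ : ℕ) (w : Arc → ℝ) (z : ℝ) : Set where
    field
      edge   : ∀ i j (a : i ~ j) → w (i , j , a) + w (j , i , ~-sym a) ≈ 1ℝ
      cycle  : ∀ (C : Cycle) →
               sum (map w (Cycle.arcs C)) ≤ fromℕ (length (Cycle.arcs C)) - 1ℝ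
      path   : ∀ (p : Path) → length (Path.arcs p) ≡ κ →
               sum (map w (Path.arcs p)) ≤ z
      binary : ∀ a → w a ≈ 0ℝ ⊎ w a ≈ 1ℝ
      z≥0    : 0ℝ ≤ z
      z≤κ    : z ≤ fromℕ κ

  Optimal : ℕ → (Arc → ℝ) → ℝ → Set
  Optimal κ w z = Feasible κ w z × (∀ w′ z′ → Feasible κ w′ z′ → z ≤ z′)

-- A colouring c with χ colours orients every edge towards its larger colour.
-- Colours strictly increase along a directed path of this orientation, so it has
-- no directed cycle and no directed path with χ or more arcs. As κ ≥ χ, every
-- path of D with κ arcs has an arc of weight 0, hence z = κ − 1 is feasible.
module Submission where

open import Defs
open import Data.Nat.Base as ℕ using (ℕ; suc; z≤n; s≤s; _⊓_; _∸_)
import Data.Nat.Properties as ℕₚ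
import Data.Nat.ListAction as ℕList
open import Data.Integer.Base as ℤ using (+_; 1ℤ)
import Data.Integer.Properties as ℤₚ
open import Data.Rational.Base as ℚ using (ℚ; 0ℚ; 1ℚ; ½; *≤*)
open import Data.Rational.Literals using (fromℤ)
import Data.Rational.Properties as ℚₚ
open import Data.Fin.Base using (toℕ)
open import Data.Fin.Properties using (toℕ<n; toℕ-injective)
open import Data.List.Base using (List; []; _∷_; _∷ʳ_; map; foldl; length)
open import Data.List.Properties using (foldl-∷ʳ; length-++)
open import Data.List.Relation.Unary.Linked using (Linked; [-]; _∷_)
open import Data.Product.Base using (_,_)
open import Data.Sum.Base using (_⊎_; inj₁; inj₂)
open import Function.Base using (_∘_; const; flip)
open import Relation.Binary.Definitions using (tri<; tri≈; tri>)
open import Relation.Nullary.Negation using (contradiction)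
open import Relation.Binary.PropositionalEquality
  using (_≡_; refl; trans; cong; cong₂; subst; subst₂; sym; _≢_; module ≡-Reasoning)

ι : ℕ → ℚ
ι n = + n ℚ./ 1

-- `_/_` divides by a gcd, so `ι n` is stuck for a variable `n`. The right-hand side is a literal
-- fraction with denominator 1, on which sums and order compute.
ι≡fromℤ : ∀ n → ι n ≡ fromℤ (+ n)
ι≡fromℤ n = ℚₚ.↥p/↧p≡p (fromℤ (+ n))

ι-homo-+ : ∀ m n → ι m ℚ.+ ι n ≡ ι (m ℕ.+ n)
ι-homo-+ m n = trans (cong₂ ℚ._+_ (ι≡fromℤ m) (ι≡fromℤ n))
  (cong (ℚ._/ 1) (cong₂ ℤ._+_ (ℤₚ.*-identityʳ (+ m)) (ℤₚ.*-identityʳ (+ n))))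

ι-mono-≤ : ∀ {m n} → m ℕ.≤ n → ι m ℚ.≤ ι n
ι-mono-≤ {m} {n} m≤n = subst₂ ℚ._≤_ (sym (ι≡fromℤ m)) (sym (ι≡fromℤ n))
  (*≤* (ℤₚ.*-monoʳ-≤-nonNeg (+ 1) (ℤ.+≤+ m≤n)))

ι-suc-1 : ∀ n → ι (suc n) ℚ.- 1ℚ ≡ ι n
ι-suc-1 n = begin
  ι (suc n) ℚ.- 1ℚ          ≡⟨ cong (λ k → ι k ℚ.- 1ℚ) (ℕₚ.+-comm 1 n) ⟩
  ι (n ℕ.+ 1) ℚ.- 1ℚ        ≡⟨ cong (ℚ._- 1ℚ) (ι-homo-+ n 1) ⟨
  (ι n ℚ.+ 1ℚ) ℚ.- 1ℚ       ≡⟨ ℚₚ.+-assoc (ι n) 1ℚ (ℚ.- 1ℚ) ⟩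
  ι n ℚ.+ (1ℚ ℚ.- 1ℚ)       ≡⟨ ℚₚ.+-identityʳ (ι n) ⟩
  ι n                       ∎
  where open ≡-Reasoning

≤-pointwise : ∀ x y → (∀ n → seq x n ℚ.≤ seq y n) → x ≤ y
≤-pointwise x y x≤y ε 0<ε = 0 , λ n _ → begin
  seq x n          ≤⟨ x≤y n ⟩
  seq y n          ≡⟨ ℚₚ.+-identityʳ (seq y n) ⟨
  seq y n ℚ.+ 0ℚ   ≤⟨ ℚₚ.+-monoʳ-≤ (seq y n) (ℚₚ.<⇒≤ 0<ε) ⟩
  seq y n ℚ.+ ε    ∎
  where open ℚₚ.≤-Reasoning

≈-pointwise : ∀ x y → (∀ n → seq x n ≡ seq y n) → x ≈ y
≈-pointwise x y x≡y ε 0<ε = 0 , λ n _ → subst (λ r → ℚ.∣ r ∣ ℚ.< ε)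
  (sym (trans (cong (ℚ._- seq y n) (x≡y n)) (ℚₚ.+-inverseʳ (seq y n)))) 0<ε

fromℕ-mono-≤ : ∀ {m n} → m ℕ.≤ n → fromℕ m ≤ fromℕ n
fromℕ-mono-≤ {m} {n} m≤n = ≤-pointwise (fromℕ m) (fromℕ n) λ _ → ι-mono-≤ m≤n

fromℕ-cong : ∀ {m n} → m ≡ n → fromℕ m ≈ fromℕ n
fromℕ-cong {m} {n} m≡n = ≈-pointwise (fromℕ m) (fromℕ n) λ _ → cong ι m≡n

-- Strict order asks for a rational gap. The unit between `n` and `suc n` is halved: one `½` is the
-- tolerance spent on `≤`, the other is the gap.
≤⇒<fromℕ-suc : ∀ x n → x ≤ fromℕ n → x < fromℕ (suc n)
≤⇒<fromℕ-suc x n x≤n with x≤n ½ (ℚₚ.positive⁻¹ ½)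
... | N , bound = ½ , ℚₚ.positive⁻¹ ½ , N , λ k N≤k → begin
  seq x k ℚ.+ ½          ≤⟨ ℚₚ.+-monoˡ-≤ ½ (bound k N≤k) ⟩
  (ι n ℚ.+ ½) ℚ.+ ½      ≡⟨ ℚₚ.+-assoc (ι n) ½ ½ ⟩
  ι n ℚ.+ ι 1            ≡⟨ ι-homo-+ n 1 ⟩
  ι (n ℕ.+ 1)            ≡⟨ cong ι (ℕₚ.+-comm n 1) ⟩
  ι (suc n)              ∎
  where open ℚₚ.≤-Reasoning

-- Turns the real constraints on 0/1 weights into inequalities between natural numbers.
seq-sum-fromℕ : ∀ {A : Set} (f : A → ℕ) as n →
  seq (sum (map (fromℕ ∘ f) as)) n ≡ ι (ℕList.sum (map f as))
seq-sum-fromℕ f []       n = refl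
seq-sum-fromℕ f (a ∷ as) n =
  trans (cong (ι (f a) ℚ.+_) (seq-sum-fromℕ f as n)) (ι-homo-+ (f a) _)

-- The indicator of `m < n`, by truncated subtraction.
ascent : ℕ → ℕ → ℕ
ascent m n = 1 ⊓ (n ∸ m)

<⇒ascent≡1 : ∀ {m n} → m ℕ.< n → ascent m n ≡ 1
<⇒ascent≡1 m<n = ℕₚ.m≤n⇒m⊓n≡m (ℕₚ.m<n⇒0<n∸m m<n)

≥⇒ascent≡0 : ∀ {m n} → n ℕ.≤ m → ascent m n ≡ 0
≥⇒ascent≡0 n≤m = cong (1 ⊓_) (ℕₚ.m≤n⇒m∸n≡0 n≤m)

ascent≤1 : ∀ m n → ascent m n ℕ.≤ 1
ascent≤1 m n = ℕₚ.m⊓n≤m 1 (n ∸ m)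

ascent+descent≡1 : ∀ {m n} → m ≢ n → ascent m n ℕ.+ ascent n m ≡ 1
ascent+descent≡1 {m} {n} m≢n with ℕₚ.<-cmp m n
... | tri< m<n _ _ = cong₂ ℕ._+_ (<⇒ascent≡1 m<n) (≥⇒ascent≡0 (ℕₚ.<⇒≤ m<n))
... | tri≈ _ m≡n _ = contradiction m≡n m≢n
... | tri> _ _ m>n = cong₂ ℕ._+_ (≥⇒ascent≡0 (ℕₚ.<⇒≤ m>n)) (<⇒ascent≡1 m>n)

module _ (G : Graph) where
  open Graph G

  length-linkedArcs : ∀ {v vs} (l : Linked _~_ (v ∷ vs)) →
    length (linkedArcs G l) ≡ length vs
  length-linkedArcs [-]     = refl
  length-linkedArcs (_ ∷ l) = cong suc (length-linkedArcs l)

  -- The last vertex of a walk. As a left fold, `endpoint v (u ∷ us)` is `endpoint u us` by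
  -- computation.
  endpoint : V → List V → V
  endpoint = foldl (flip const)

  module Orientation (h : V → ℕ) where

    weight : Arc G → ℕ
    weight (i , j , _) = ascent (h i) (h j)

    total : List (Arc G) → ℕ
    total = ℕList.sum ∘ map weight

    total≤length : ∀ as → total as ℕ.≤ length as
    total≤length []                 = z≤n
    total≤length ((i , j , _) ∷ as) =
      ℕₚ.+-mono-≤ (ascent≤1 (h i) (h j)) (total≤length as)

    -- Either some arc weighs 0 while the others weigh at most 1, or every arc raises `h` by at
    -- least 1. Serves cycles and paths alike.
    total<length⊎climb : ∀ {v vs} (l : Linked _~_ (v ∷ vs)) →
      let as = linkedArcs G l in
      total as ℕ.< length as ⊎ h v ℕ.+ length as ℕ.≤ h (endpoint v vs)
    total<length⊎climb {v} [-] = inj₂ (ℕₚ.≤-reflexive (ℕₚ.+-identityʳ (h v)))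
    total<length⊎climb {v} {u ∷ _} (a ∷ l) with ℕₚ.<-≤-connex (h v) (h u)
    -- The first arc weighs 0, which already costs one unit.
    ... | inj₂ hu≤hv rewrite ≥⇒ascent≡0 hu≤hv = inj₁ (s≤s (total≤length (linkedArcs G l)))
    ... | inj₁ hv<hu with total<length⊎climb l
    ...   | inj₁ total<length = inj₁ (ℕₚ.+-mono-≤-< (ascent≤1 (h v) (h u)) total<length)
    ...   | inj₂ climb        = inj₂ (begin
      h v ℕ.+ suc k   ≡⟨ ℕₚ.+-suc (h v) k ⟩
      suc (h v) ℕ.+ k ≤⟨ ℕₚ.+-monoˡ-≤ k hv<hu ⟩
      h u ℕ.+ k       ≤⟨ climb ⟩
      _               ∎)
      where open ℕₚ.≤-Reasoning
            k = length (linkedArcs G l)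

    -- A closed walk with at least one arc cannot climb throughout, since it ends at the height
    -- where it began.
    cycle-total< : (C : Cycle G) → total (Cycle.arcs C) ℕ.< length (Cycle.arcs C)
    cycle-total< record { start = s ; rest = r ; linked = l } with total<length⊎climb l
    ... | inj₁ total<length = total<length
    ... | inj₂ climb        = contradiction (begin-strict
      h s                              <⟨ ℕₚ.m<m+n (h s) (ℕₚ.0<1+n {length r}) ⟩
      h s ℕ.+ suc (length r)           ≡⟨ cong (h s ℕ.+_) |as|≡1+|r| ⟨
      h s ℕ.+ length (linkedArcs G l)  ≤⟨ climb ⟩
      h (endpoint s (r ∷ʳ s))          ≡⟨ cong h (foldl-∷ʳ (flip const) s s r) ⟩
      h s                              ∎) (ℕₚ.<-irrefl refl)
      where
      open ℕₚ.≤-Reasoning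
      |as|≡1+|r| : length (linkedArcs G l) ≡ suc (length r)
      |as|≡1+|r| = trans (length-linkedArcs l)
        (trans (length-++ r) (ℕₚ.+-comm (length r) 1))

    -- A climb along all of `p` would give its endpoint a height of at least the number of arcs.
    path-total< : (p : Path G) → (∀ v → h v ℕ.< length (Path.arcs p)) →
      total (Path.arcs p) ℕ.< length (Path.arcs p)
    path-total< p h<length with total<length⊎climb (Path.linked p)
    ... | inj₁ total<length = total<length
    ... | inj₂ climb        = contradiction (ℕₚ.m+n≤o⇒n≤o _ climb) (ℕₚ.<⇒≱ (h<length _))

    orientation-feasible : ∀ n → (∀ {i j} → i ~ j → h i ≢ h j) →
      (∀ v → h v ℕ.≤ n) → Feasible G (suc n) (fromℕ ∘ weight) (fromℕ n)
    orientation-feasible n proper h≤n = record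
      { edge   = λ i j a → ≈-pointwise
                   (fromℕ (weight (i , j , a)) + fromℕ (weight (j , i , ~-sym a))) 1ℝ λ _ →
                   trans (ι-homo-+ (weight (i , j , a)) (weight (j , i , ~-sym a)))
                         (cong ι (ascent+descent≡1 (proper a)))
      ; cycle  = λ C → ≤-pointwise (sum (map (fromℕ ∘ weight) (Cycle.arcs C)))
                   (fromℕ (length (Cycle.arcs C)) - 1ℝ) λ k → begin
          seq (sum (map (fromℕ ∘ weight) (Cycle.arcs C))) k
            ≡⟨ seq-sum-fromℕ weight (Cycle.arcs C) k ⟩
          ι (total (Cycle.arcs C))
            -- Between natural numbers, `total < length` means `suc total ≤ length`; this supplies
            -- the `- 1` of the cycle constraint.
            ≡⟨ ι-suc-1 (total (Cycle.arcs C)) ⟨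
          ι (suc (total (Cycle.arcs C))) ℚ.- 1ℚ
            ≤⟨ ℚₚ.+-monoˡ-≤ (ℚ.- 1ℚ) (ι-mono-≤ (cycle-total< C)) ⟩
          ι (length (Cycle.arcs C)) ℚ.- 1ℚ ∎
      ; path   = λ p |p|≡1+n → ≤-pointwise (sum (map (fromℕ ∘ weight) (Path.arcs p)))
                   (fromℕ n) λ k → begin
          seq (sum (map (fromℕ ∘ weight) (Path.arcs p))) k
            ≡⟨ seq-sum-fromℕ weight (Path.arcs p) k ⟩
          ι (total (Path.arcs p))
            ≤⟨ ι-mono-≤ (ℕₚ.≤-pred (subst (total (Path.arcs p) ℕ.<_) |p|≡1+n
                 (path-total< p λ v → subst (h v ℕ.<_) (sym |p|≡1+n) (s≤s (h≤n v))))) ⟩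
          ι n ∎
      ; binary = binary
      ; z≥0    = fromℕ-mono-≤ {0} {n} z≤n
      ; z≤κ    = fromℕ-mono-≤ {n} {suc n} (ℕₚ.n≤1+n n)
      }
      where
      open ℚₚ.≤-Reasoning
      binary : ∀ a → fromℕ (weight a) ≈ 0ℝ ⊎ fromℕ (weight a) ≈ 1ℝ
      binary (i , j , _) with ℕₚ.<-≤-connex (h i) (h j)
      ... | inj₁ hi<hj = inj₂ (fromℕ-cong (<⇒ascent≡1 hi<hj))
      ... | inj₂ hj≤hi = inj₁ (fromℕ-cong (≥⇒ascent≡0 hj≤hi))

proposition2 : (G : Graph) (χ : ℕ) → IsChromaticNumber G χ →
    let q = + χ ℤ.- 1ℤ in
    (κ : ℕ) → 0 ℕ.< κ → + κ ℤ.≥ q ℤ.+ 1ℤ →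
    (w* : Arc G → ℝ) (z* : ℝ) → Optimal G κ w* z* → z* < fromℕ κ
-- Positivity of `κ` gives `κ = suc n`. The colours serve as heights, and minimality is tested
-- against the feasible value `n`.
proposition2 G χ ((c , proper) , _) (suc n) _ κ≥q+1 w* z* (_ , minimal) =
  ≤⇒<fromℕ-suc z* n (minimal _ (fromℕ n)
    (orientation-feasible n (λ a → proper a ∘ toℕ-injective)
      (λ v → ℕₚ.≤-pred (ℕₚ.≤-trans (toℕ<n (c v)) χ≤κ))))
  where
  open Orientation G (toℕ ∘ c)
  χ≤κ : χ ℕ.≤ suc n
  -- In the integers `q + 1` is exactly `χ`, even for `χ = 0`, where truncated subtraction would
  -- yield 1.
  χ≤κ = ℤₚ.drop‿+≤+ (subst (ℤ._≤ + suc n)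
    (trans (ℤₚ.+-assoc (+ χ) (ℤ.- 1ℤ) 1ℤ) (ℤₚ.+-identityʳ (+ χ))) κ≥q+1)
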